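{- Let $n\in\mathbb{N}$, $n>1$, and let $h\in\mathcal{I}$. Then $$d^{(n)}_{(h,\cdot)}(x,y)=\begin{cases}0&\text{for }x=y,\\ 1-h(\gcd(x,n))\cdot h(\gcd(y,n))&\text{for }x\ne y,\end{cases}\qquad x,y\in\mathbb{Z},$$ is a pseudometric on $\mathbb{Z}$, and so also on $D_n$. If $h\in\mathcal{I}_1$, then $d^{(n)}_{(h,\cdot)}$ is a metric on $D_n$.
   Context: $\mathbb{N}$ is the set of positive integers and $D_n=\{x\in\mathbb{N}: x\mid n\}$. A function $h:\mathbb{N}\to\mathbb{R}$ is multiplicative if $h$ is not identically zero and $h(xy)=h(x)h(y)$ for all coprime $x,y\in\mathbb{N}$. $\mathcal{I}$ is the set of multiplicative $h$ with $0\le h(x)\le1$ for all $x>1$; $\mathcal{I}_1$ is the set of $h\in\mathcal{I}$ with $0\le h(x)<1$ for all $x>1$. A pseudometric on $S$ is a function $d:S\times S\to\mathbb{R}$ with $d(x,x)=0$, $d(x,y)=d(y,x)$ and $d(x,z)\le d(x,y)+d(y,z)$; it is a metric if moreover $d(x,y)=0\Rightarrow x=y$. -}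

module Defs where

open import Data.Integer as ℤ using (ℤ; +_)
open import Data.Irrelevant using ([_])
open import Data.Nat as ℕ using (ℕ; NonZero; ≢-nonZero)
open import Data.Nat.Coprimality using (Coprime)
open import Data.Nat.Divisibility using (_∣_)
open import Data.Nat.GCD using (gcd; gcd[m,n]≢0)
import Data.Nat.Properties as ℕ
open import Data.Product using (∃-syntax; _×_; _,_)
open import Data.Rational as ℚ using (ℚ; 0ℚ; 1ℚ; ½; ∣_∣)
import Data.Rational.Properties as ℚ
open import Data.Rational.Solver using (module +-*-Solver)
open import Data.Refinement using (Refinement-syntax; value) renaming (_,_ to _,ᵣ_)
open import Data.Sum using (inj₂)
open import Function using (_on_)
open import Function.Metric.Core using (DistanceFunction)
open import Function.Metric.Definitions using (Symmetric; TriangleInequality; Indiscernable)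
open import Relation.Binary.PropositionalEquality
  using (_≡_; refl; sym; trans; cong; cong₂; subst; subst₂)
open import Relation.Nullary using (¬_; yes; no)

------------------------------------------------------------------------
-- The real numbers (Cantor's construction): Cauchy sequences of
-- rationals, compared by the setoid equality _≈_ in place of a quotient.

IsCauchy : (ℕ → ℚ) → Set
IsCauchy a = ∀ ε → 0ℚ ℚ.< ε →
  ∃[ N ] (∀ i j → N ℕ.≤ i → N ℕ.≤ j → ∣ a i ℚ.- a j ∣ ℚ.< ε)

record ℝ : Set where
  constructor mkℝ
  field
    seq    : ℕ → ℚ
    cauchy : IsCauchy seq
open ℝ public

infix 4 _≈_ _≤_ _<_

_≈_ : ℝ → ℝ → Set
x ≈ y = ∀ ε → 0ℚ ℚ.< ε →
  ∃[ N ] (∀ i → N ℕ.≤ i → ∣ seq x i ℚ.- seq y i ∣ ℚ.< ε)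

-- The slack ε is needed: eventual termwise ≤ is not invariant under _≈_.
_≤_ : ℝ → ℝ → Set
x ≤ y = ∀ ε → 0ℚ ℚ.< ε →
  ∃[ N ] (∀ i → N ℕ.≤ i → seq x i ℚ.≤ seq y i ℚ.+ ε)

_<_ : ℝ → ℝ → Set
x < y = ∃[ ε ] (0ℚ ℚ.< ε ×
  ∃[ N ] (∀ i → N ℕ.≤ i → seq x i ℚ.+ ε ℚ.≤ seq y i))

private
  half-pos : ∀ {ε} → 0ℚ ℚ.< ε → 0ℚ ℚ.< ½ ℚ.* ε
  half-pos {ε} 0<ε = subst (ℚ._< ½ ℚ.* ε) (ℚ.*-zeroʳ ½) (ℚ.*-monoʳ-<-pos ½ 0<ε)

  half+half : ∀ ε → ½ ℚ.* ε ℚ.+ ½ ℚ.* ε ≡ ε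
  half+half ε = trans (sym (ℚ.*-distribʳ-+ ε ½ ½)) (ℚ.*-identityˡ ε)

  ⊔-split : ∀ M N {i} → M ℕ.⊔ N ℕ.≤ i → M ℕ.≤ i × N ℕ.≤ i
  ⊔-split M N p = ℕ.≤-trans (ℕ.m≤m⊔n M N) p , ℕ.≤-trans (ℕ.m≤n⊔m M N) p

  const-cauchy : ∀ q → IsCauchy (λ _ → q)
  const-cauchy q ε 0<ε = 0 , λ _ _ _ _ →
    subst (λ r → ∣ r ∣ ℚ.< ε) (sym (ℚ.+-inverseʳ q)) 0<ε

  +-cauchy : ∀ a b → IsCauchy a → IsCauchy b → IsCauchy (λ i → a i ℚ.+ b i)
  +-cauchy a b ca cb ε 0<ε
    with M , p ← ca (½ ℚ.* ε) (half-pos 0<ε)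
       | N , q ← cb (½ ℚ.* ε) (half-pos 0<ε) = M ℕ.⊔ N , λ i j i≥ j≥ →
    let (iM , iN) = ⊔-split M N i≥
        (jM , jN) = ⊔-split M N j≥
    in subst₂ (λ r s → ∣ r ∣ ℚ.< s) (regroup (a i) (a j) (b i) (b j)) (half+half ε)
         (ℚ.≤-<-trans (ℚ.∣p+q∣≤∣p∣+∣q∣ (a i ℚ.- a j) (b i ℚ.- b j))
           (ℚ.+-mono-< (p i j iM jM) (q i j iN jN)))
    where
    regroup : ∀ w x y z → (w ℚ.- x) ℚ.+ (y ℚ.- z) ≡ (w ℚ.+ y) ℚ.- (x ℚ.+ z)
    regroup = solve 4 (λ w x y z →
      (w :- x) :+ (y :- z) := (w :+ y) :- (x :+ z)) refl
      where open +-*-Solver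

  neg-cauchy : ∀ a → IsCauchy a → IsCauchy (λ i → ℚ.- a i)
  neg-cauchy a ca ε 0<ε with N , p ← ca ε 0<ε = N , λ i j i≥ j≥ →
    subst (ℚ._< ε)
      (trans (sym (ℚ.∣-p∣≡∣p∣ (a i ℚ.- a j)))
        (cong ∣_∣ (ℚ.neg-distrib-+ (a i) (ℚ.- a j))))
      (p i j i≥ j≥)

  EventuallyBounded : (ℕ → ℚ) → Set
  EventuallyBounded a =
    ∃[ B ] (0ℚ ℚ.< B × ∃[ N ] (∀ i → N ℕ.≤ i → ∣ a i ∣ ℚ.< B))

  cauchy⇒bounded : ∀ a → IsCauchy a → EventuallyBounded a
  cauchy⇒bounded a ca with N , p ← ca 1ℚ (ℚ.positive⁻¹ 1ℚ) =
    B , ℚ.≤-<-trans (ℚ.0≤∣p∣ (a N)) (bound N ℕ.≤-refl) , N , bound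
    where
    B : ℚ
    B = 1ℚ ℚ.+ ∣ a N ∣
    cancel : ∀ x y → (x ℚ.- y) ℚ.+ y ≡ x
    cancel = solve 2 (λ x y → (x :- y) :+ y := x) refl
      where open +-*-Solver
    bound : ∀ i → N ℕ.≤ i → ∣ a i ∣ ℚ.< B
    bound i i≥ = subst (λ r → ∣ r ∣ ℚ.< B) (cancel (a i) (a N))
      (ℚ.≤-<-trans (ℚ.∣p+q∣≤∣p∣+∣q∣ (a i ℚ.- a N) (a N))
        (ℚ.+-monoˡ-< ∣ a N ∣ (p i N i≥ ℕ.≤-refl)))

  quotient : ∀ {ε B} → 0ℚ ℚ.< ε → 0ℚ ℚ.< B → ∃[ δ ] (0ℚ ℚ.< δ × B ℚ.* δ ≡ ε)
  quotient {ε} {B} 0<ε 0<B = δ , ℚ.positive⁻¹ δ , eq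
    where
    instance
      _ = ℚ.positive 0<ε
      B-pos = ℚ.positive 0<B
      B≢0 = ℚ.pos⇒nonZero B {{B-pos}}
      _ = ℚ.1/pos⇒pos B
    δ : ℚ
    δ = (ℚ.1/ B) ℚ.* ε
    instance
      _ = ℚ.pos*pos⇒pos (ℚ.1/ B) ε
    eq : B ℚ.* δ ≡ ε
    eq = trans (sym (ℚ.*-assoc B (ℚ.1/ B) ε))
      (trans (cong (ℚ._* ε) (ℚ.*-inverseʳ B)) (ℚ.*-identityˡ ε))

  ∣*∣-bound : ∀ x y {B δ} → 0ℚ ℚ.< B → ∣ x ∣ ℚ.< B → ∣ y ∣ ℚ.< δ →
              ∣ x ℚ.* y ∣ ℚ.< B ℚ.* δ
  ∣*∣-bound x y {B} {δ} 0<B x<B y<δ =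
    subst (ℚ._< B ℚ.* δ) (sym (ℚ.∣p*q∣≡∣p∣*∣q∣ x y))
      (ℚ.≤-<-trans
        (ℚ.*-monoʳ-≤-nonNeg ∣ y ∣ {{ℚ.∣-∣-nonNeg y}} (ℚ.<⇒≤ x<B))
        (ℚ.*-monoʳ-<-pos B {{ℚ.positive 0<B}} y<δ))

  *-close : ∀ w x y z {A B α β ε} → 0ℚ ℚ.< A → 0ℚ ℚ.< B →
            B ℚ.* α ≡ ½ ℚ.* ε → A ℚ.* β ≡ ½ ℚ.* ε →
            ∣ w ∣ ℚ.< A → ∣ z ∣ ℚ.< B →
            ∣ w ℚ.- x ∣ ℚ.< α → ∣ y ℚ.- z ∣ ℚ.< β →
            ∣ w ℚ.* y ℚ.- x ℚ.* z ∣ ℚ.< ε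
  *-close w x y z {A} {B} {α} {β} {ε} 0<A 0<B Bα≡ Aβ≡ w<A z<B w-x<α y-z<β =
    subst₂ (λ r s → ∣ r ∣ ℚ.< s) (regroup w x y z)
      (trans (cong₂ ℚ._+_ Aβ≡ Bα≡) (half+half ε))
      (ℚ.≤-<-trans
        (ℚ.∣p+q∣≤∣p∣+∣q∣ (w ℚ.* (y ℚ.- z)) (z ℚ.* (w ℚ.- x)))
        (ℚ.+-mono-< (∣*∣-bound w (y ℚ.- z) 0<A w<A y-z<β)
                    (∣*∣-bound z (w ℚ.- x) 0<B z<B w-x<α)))
    where
    regroup : ∀ w x y z →
      w ℚ.* (y ℚ.- z) ℚ.+ z ℚ.* (w ℚ.- x) ≡ w ℚ.* y ℚ.- x ℚ.* z
    regroup = solve 4 (λ w x y z →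
      w :* (y :- z) :+ z :* (w :- x) := w :* y :- x :* z) refl
      where open +-*-Solver

  *-cauchy : ∀ a b → IsCauchy a → IsCauchy b → IsCauchy (λ i → a i ℚ.* b i)
  *-cauchy a b ca cb ε 0<ε =
    let (A , 0<A , M₁ , boundᵃ) = cauchy⇒bounded a ca
        (B , 0<B , N₁ , boundᵇ) = cauchy⇒bounded b cb
        (α , 0<α , Bα≡) = quotient {½ ℚ.* ε} {B} (half-pos 0<ε) 0<B
        (β , 0<β , Aβ≡) = quotient {½ ℚ.* ε} {A} (half-pos 0<ε) 0<A
        (M₂ , p) = ca α 0<α
        (N₂ , q) = cb β 0<β
    in (M₁ ℕ.⊔ N₁) ℕ.⊔ (M₂ ℕ.⊔ N₂) , λ i j i≥ j≥ →
      let (i₁ , i₂)   = ⊔-split (M₁ ℕ.⊔ N₁) (M₂ ℕ.⊔ N₂) i≥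
          (j₁ , j₂)   = ⊔-split (M₁ ℕ.⊔ N₁) (M₂ ℕ.⊔ N₂) j≥
          (iM₁ , _)   = ⊔-split M₁ N₁ i₁
          (_ , jN₁)   = ⊔-split M₁ N₁ j₁
          (iM₂ , iN₂) = ⊔-split M₂ N₂ i₂
          (jM₂ , jN₂) = ⊔-split M₂ N₂ j₂
      in *-close (a i) (a j) (b i) (b j) 0<A 0<B Bα≡ Aβ≡
           (boundᵃ i iM₁) (boundᵇ j jN₁) (p i j iM₂ jM₂) (q i j iN₂ jN₂)

infixl 7 _*_
infixl 6 _+_ _-_
infix  8 -_

fromℚ : ℚ → ℝ
fromℚ q = mkℝ (λ _ → q) (const-cauchy q)

0ℝ 1ℝ : ℝ
0ℝ = fromℚ 0ℚ
1ℝ = fromℚ 1ℚ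

_+_ _*_ : ℝ → ℝ → ℝ
x + y = mkℝ (λ i → seq x i ℚ.+ seq y i) (+-cauchy (seq x) (seq y) (cauchy x) (cauchy y))
x * y = mkℝ (λ i → seq x i ℚ.* seq y i) (*-cauchy (seq x) (seq y) (cauchy x) (cauchy y))

-_ : ℝ → ℝ
- x = mkℝ (λ i → ℚ.- seq x i) (neg-cauchy (seq x) (cauchy x))

_-_ : ℝ → ℝ → ℝ
x - y = x + (- y)

------------------------------------------------------------------------
-- Positive integers and divisors.  The membership proofs are irrelevant,
-- so _≡_ on ℕ⁺ and on D n amounts to equality of the underlying numbers.

ℕ⁺ : Set
ℕ⁺ = [ x ∈ ℕ ∣ NonZero x ]

infixl 7 _*⁺_

_*⁺_ : ℕ⁺ → ℕ⁺ → ℕ⁺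
(x ,ᵣ [ x≢0 ]) *⁺ (y ,ᵣ [ y≢0 ]) = x ℕ.* y ,ᵣ [ ℕ.m*n≢0 x y {{x≢0}} {{y≢0}} ]

gcd⁺ : ℤ → ℕ⁺ → ℕ⁺
gcd⁺ x (n ,ᵣ [ n≢0 ]) =
  gcd ℤ.∣ x ∣ n ,ᵣ
  [ ≢-nonZero (gcd[m,n]≢0 ℤ.∣ x ∣ n (inj₂ (ℕ.≢-nonZero⁻¹ n {{n≢0}}))) ]

D : ℕ⁺ → Set
D n = [ x ∈ ℕ⁺ ∣ (value x ∣ value n) ]

D→ℤ : ∀ {n} → D n → ℤ
D→ℤ x = + value (value x)

------------------------------------------------------------------------
-- Multiplicative functions

record IsMultiplicative (h : ℕ⁺ → ℝ) : Set where
  field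
    not-zero : ¬ (∀ x → h x ≈ 0ℝ)
    mult     : ∀ x y → Coprime (value x) (value y) → h (x *⁺ y) ≈ h x * h y

record 𝓘 (h : ℕ⁺ → ℝ) : Set where
  field
    multiplicative : IsMultiplicative h
    -- Only x > 1 is constrained; h 1 = 1 follows from multiplicativity.
    bounds         : ∀ x → 1 ℕ.< value x → 0ℝ ≤ h x × h x ≤ 1ℝ

record 𝓘₁ (h : ℕ⁺ → ℝ) : Set where
  field
    ∈𝓘            : 𝓘 h
    strict-bounds : ∀ x → 1 ℕ.< value x → 0ℝ ≤ h x × h x < 1ℝ

------------------------------------------------------------------------
-- Pseudometrics and metrics

record IsPseudometric {S : Set} (d : DistanceFunction S ℝ) : Set where
  field
    self     : ∀ x → d x x ≈ 0ℝ
    symm     : Symmetric _≈_ d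
    triangle : TriangleInequality _≤_ _+_ d

record IsMetric {S : Set} (d : DistanceFunction S ℝ) : Set where
  field
    isPseudometric : IsPseudometric d
    indiscernable  : Indiscernable _≡_ _≈_ d 0ℝ

dist : ℕ⁺ → (ℕ⁺ → ℝ) → DistanceFunction ℤ ℝ
dist n h x y with x ℤ.≟ y
... | yes _ = 0ℝ
... | no  _ = 1ℝ - h (gcd⁺ x n) * h (gcd⁺ y n)

distD : (n : ℕ⁺) → (ℕ⁺ → ℝ) → DistanceFunction (D n) ℝ
distD n h = dist n h on D→ℤ {n}

{-# OPTIONS --safe #-}

-- Put a = h (gcd (x , n)), b = h (gcd (y , n)), c = h (gcd (z , n)); all lie in
-- the unit interval (h 1 because h 1 = (h 1)²).  For distinct x, y, z the triangle inequality
-- 1 − ac ≤ (1 − ab) + (1 − bc) is witnessed by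
--   (1 − ab) + (1 − bc) − (1 − ac) = (1 − a)(1 − c) + (a + c)(1 − b) ≥ 0.
-- For h ∈ 𝓘₁ and distinct divisors x, y of n, one of them exceeds 1, say x;
-- then ab ≤ a = h x < 1.
module Submission where

open import Defs
import Data.Integer.Properties as ℤ
open import Data.Irrelevant using ([_])
open import Data.Nat as ℕ using (ℕ; zero; suc; NonZero; s≤s; z≤n)
open import Data.Nat.Coprimality using (1-coprimeTo)
open import Data.Nat.Divisibility using (_∣?_; ∣-refl; ∣-antisym)
open import Data.Nat.GCD using (gcd[m,n]∣m; gcd-greatest)
import Data.Nat.Properties as ℕ
open import Data.Product using (∃-syntax; _×_; _,_)
open import Data.Rational as ℚ using (ℚ; 0ℚ; 1ℚ; ½; ∣_∣)
import Data.Rational.Properties as ℚ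
open import Data.Rational.Solver using (module +-*-Solver)
open import Data.Refinement using (value) renaming (_,_ to _,ᵣ_)
open import Data.Refinement.Properties using (value-injective; _≟_)
open import Data.Sum using (_⊎_; inj₁; inj₂; [_,_]′)
open import Function using (_on_)
open import Function.Metric.Core using (DistanceFunction)
open import Relation.Binary.PropositionalEquality
  using (_≡_; _≢_; refl; sym; trans; cong; subst; subst₂)
open import Relation.Nullary using (¬_; yes; no; contradiction; recompute)
open import Relation.Nullary.Decidable using (decidable-stable)

private
  variable
    p q r B : ℚ

-- Rationals

-- Reduces an inequality to a nonnegative difference `r` and a ring identity that the solver can
-- check.
gap⇒≤ : ∀ r → 0ℚ ℚ.≤ r → r ℚ.+ p ≡ q → p ℚ.≤ q
gap⇒≤ {p} r 0≤r eq = subst₂ ℚ._≤_ (ℚ.+-identityˡ p) eq (ℚ.+-monoˡ-≤ p 0≤r)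

≤⇒0≤gap : p ℚ.≤ q → 0ℚ ℚ.≤ q ℚ.- p
≤⇒0≤gap {p} {q} p≤q =
  subst (ℚ._≤ q ℚ.- p) (ℚ.+-inverseʳ p) (ℚ.+-monoˡ-≤ (ℚ.- p) p≤q)

0≤p*q : 0ℚ ℚ.≤ p → 0ℚ ℚ.≤ q → 0ℚ ℚ.≤ p ℚ.* q
0≤p*q {p} {q} 0≤p 0≤q = ℚ.nonNegative⁻¹ (p ℚ.* q)
  {{ℚ.nonNeg*nonNeg⇒nonNeg p {{ℚ.nonNegative 0≤p}} q {{ℚ.nonNegative 0≤q}}}}

0≤p*p : ∀ p → 0ℚ ℚ.≤ p ℚ.* p
0≤p*p p with ℚ.≤-total 0ℚ p
... | inj₁ 0≤p = 0≤p*q 0≤p 0≤p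
... | inj₂ p≤0 = ℚ.nonNegative⁻¹ (p ℚ.* p)
  {{ℚ.nonPos*nonPos⇒nonPos p {{ℚ.nonPositive p≤0}} p {{ℚ.nonPositive p≤0}}}}

p≤∣p∣ : ∀ p → p ℚ.≤ ∣ p ∣
p≤∣p∣ p with ℚ.≤-total 0ℚ p
... | inj₁ 0≤p = ℚ.≤-reflexive (sym (ℚ.0≤p⇒∣p∣≡p 0≤p))
... | inj₂ p≤0 = ℚ.≤-trans p≤0 (ℚ.0≤∣p∣ p)

∣p-q∣≡∣q-p∣ : ∀ p q → ∣ p ℚ.- q ∣ ≡ ∣ q ℚ.- p ∣
∣p-q∣≡∣q-p∣ p q = trans (sym (ℚ.∣-p∣≡∣p∣ (p ℚ.- q))) (cong ∣_∣ (flip p q))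
  where
  open +-*-Solver
  flip : ∀ p q → ℚ.- (p ℚ.- q) ≡ q ℚ.- p
  flip = solve 2 (λ p q → :- (p :- q) := q :- p) refl

∣p-q∣<r⇒p≤q+r : ∣ p ℚ.- q ∣ ℚ.< r → p ℚ.≤ q ℚ.+ r
∣p-q∣<r⇒p≤q+r {p} {q} {r} close =
  gap⇒≤ (r ℚ.- (p ℚ.- q))
    (≤⇒0≤gap (ℚ.≤-trans (p≤∣p∣ (p ℚ.- q)) (ℚ.<⇒≤ close)))
    (solve 3 (λ p q r → (r :- (p :- q)) :+ p := q :+ r) refl p q r)
  where open +-*-Solver

0<½*p : 0ℚ ℚ.< p → 0ℚ ℚ.< ½ ℚ.* p
0<½*p {p} 0<p = subst (ℚ._< ½ ℚ.* p) (ℚ.*-zeroʳ ½) (ℚ.*-monoʳ-<-pos ½ 0<p)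

½*p+½*p≡p : ∀ p → ½ ℚ.* p ℚ.+ ½ ℚ.* p ≡ p
½*p+½*p≡p p = trans (sym (ℚ.*-distribʳ-+ p ½ ½)) (ℚ.*-identityˡ p)

∃-divisor : 0ℚ ℚ.< p → 0ℚ ℚ.< B → ∃[ δ ] (0ℚ ℚ.< δ × B ℚ.* δ ≡ p)
∃-divisor {p} {B} 0<p 0<B = p/B , ℚ.positive⁻¹ p/B , B*p/B≡p
  where
  instance
    _ = ℚ.positive 0<p
    B-pos = ℚ.positive 0<B
    B≢0 = ℚ.pos⇒nonZero B {{B-pos}}
    _ = ℚ.1/pos⇒pos B
  p/B : ℚ
  p/B = (ℚ.1/ B) ℚ.* p
  instance
    _ = ℚ.pos*pos⇒pos (ℚ.1/ B) p
  B*p/B≡p : B ℚ.* p/B ≡ p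
  B*p/B≡p = trans (sym (ℚ.*-assoc B (ℚ.1/ B) p))
    (trans (cong (ℚ._* p) (ℚ.*-inverseʳ B)) (ℚ.*-identityˡ p))

-- The sum splits into the nonnegative products (p + δ) q and (B - q) δ.
-δ≤p⇒0≤p*q+B*δ : ∀ p q δ B → 0ℚ ℚ.≤ p ℚ.+ δ → 0ℚ ℚ.≤ q → q ℚ.≤ B → 0ℚ ℚ.≤ δ →
                  0ℚ ℚ.≤ p ℚ.* q ℚ.+ B ℚ.* δ
-δ≤p⇒0≤p*q+B*δ p q δ B 0≤p+δ 0≤q q≤B 0≤δ =
  subst (0ℚ ℚ.≤_)
    (solve 4 (λ p q δ B →
      (p :+ δ) :* q :+ (B :- q) :* δ := p :* q :+ B :* δ) refl p q δ B)
    (ℚ.+-mono-≤ (0≤p*q 0≤p+δ 0≤q) (0≤p*q (≤⇒0≤gap q≤B) 0≤δ))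
  where open +-*-Solver

-- Terms of a nonnegative real may dip below zero by δ. If one factor is nonnegative, the previous
-- bound applies with that factor as `q`; if both are nonpositive, their product is already
-- nonnegative.
almost-nonNeg-* : ∀ p q δ B → 0ℚ ℚ.≤ p ℚ.+ δ → 0ℚ ℚ.≤ q ℚ.+ δ →
                  p ℚ.≤ B → q ℚ.≤ B → 0ℚ ℚ.≤ δ → 0ℚ ℚ.≤ B →
                  0ℚ ℚ.≤ p ℚ.* q ℚ.+ B ℚ.* δ
almost-nonNeg-* p q δ B 0≤p+δ 0≤q+δ p≤B q≤B 0≤δ 0≤B
  with ℚ.≤-total 0ℚ p | ℚ.≤-total 0ℚ q
... | _ | inj₁ 0≤q = -δ≤p⇒0≤p*q+B*δ p q δ B 0≤p+δ 0≤q q≤B 0≤δ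
... | inj₁ 0≤p | _ = subst (λ t → 0ℚ ℚ.≤ t ℚ.+ B ℚ.* δ) (ℚ.*-comm q p)
                       (-δ≤p⇒0≤p*q+B*δ q p δ B 0≤q+δ 0≤p p≤B 0≤δ)
... | inj₂ p≤0 | inj₂ q≤0 = ℚ.+-mono-≤
  (ℚ.nonNegative⁻¹ (p ℚ.* q)
    {{ℚ.nonPos*nonPos⇒nonPos p {{ℚ.nonPositive p≤0}} q {{ℚ.nonPositive q≤0}}}})
  (0≤p*q 0≤B 0≤δ)

-- Real numbers

-- _≈_, _≤_ and _<_ unfold to statements about the sequences, from which the
-- reals cannot be inferred: hence the explicit arguments below.

≗⇒≈ : ∀ x y → (∀ i → seq x i ≡ seq y i) → x ≈ y
≗⇒≈ x y eq ε 0<ε = 0 , λ i _ →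
  subst (λ t → ∣ t ∣ ℚ.< ε)
    (sym (trans (cong (ℚ._- seq y i) (eq i)) (ℚ.+-inverseʳ (seq y i)))) 0<ε

≈-sym : ∀ x y → x ≈ y → y ≈ x
≈-sym x y x≈y ε 0<ε with N , close ← x≈y ε 0<ε = N , λ i i≥ →
  subst (ℚ._< ε) (∣p-q∣≡∣q-p∣ (seq x i) (seq y i)) (close i i≥)

≈-trans : ∀ x y z → x ≈ y → y ≈ z → x ≈ z
≈-trans x y z x≈y y≈z ε 0<ε
  with M , f ← x≈y (½ ℚ.* ε) (0<½*p 0<ε)
     | N , g ← y≈z (½ ℚ.* ε) (0<½*p 0<ε) = M ℕ.⊔ N , λ i i≥ →
  subst₂ (λ t u → ∣ t ∣ ℚ.< u)
    (solve 3 (λ x y z → (x :- y) :+ (y :- z) := x :- z) refl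
      (seq x i) (seq y i) (seq z i))
    (½*p+½*p≡p ε)
    (ℚ.≤-<-trans (ℚ.∣p+q∣≤∣p∣+∣q∣ (seq x i ℚ.- seq y i) (seq y i ℚ.- seq z i))
      (ℚ.+-mono-< (f i (ℕ.m⊔n≤o⇒m≤o M N i≥)) (g i (ℕ.m⊔n≤o⇒n≤o M N i≥))))
  where open +-*-Solver

≈⇒≤ : ∀ x y → x ≈ y → x ≤ y
≈⇒≤ x y x≈y ε 0<ε with N , close ← x≈y ε 0<ε =
  N , λ i i≥ → ∣p-q∣<r⇒p≤q+r (close i i≥)

≗⇒≤ : ∀ x y → (∀ i → seq x i ≡ seq y i) → x ≤ y
≗⇒≤ x y eq = ≈⇒≤ x y (≗⇒≈ x y eq)

≤-trans : ∀ x y z → x ≤ y → y ≤ z → x ≤ z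
≤-trans x y z x≤y y≤z ε 0<ε
  with M , f ← x≤y (½ ℚ.* ε) (0<½*p 0<ε)
     | N , g ← y≤z (½ ℚ.* ε) (0<½*p 0<ε) = M ℕ.⊔ N , λ i i≥ →
  ℚ.≤-trans (f i (ℕ.m⊔n≤o⇒m≤o M N i≥))
    (ℚ.≤-trans (ℚ.+-monoˡ-≤ (½ ℚ.* ε) (g i (ℕ.m⊔n≤o⇒n≤o M N i≥)))
      (ℚ.≤-reflexive (trans (ℚ.+-assoc (seq z i) (½ ℚ.* ε) (½ ℚ.* ε))
        (cong (seq z i ℚ.+_) (½*p+½*p≡p ε)))))

<⇒≱ : ∀ x y → x < y → ¬ y ≤ x
<⇒≱ x y (ε , 0<ε , M , f) y≤x
  -- With half of the strict gap as slack, an index past both moduli gives x + ε ≤ y ≤ x + ε/2,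
  -- hence ε/2 ≤ 0.
  with N , g ← y≤x (½ ℚ.* ε) (0<½*p 0<ε) =
  ℚ.<-irrefl refl (ℚ.<-≤-trans (0<½*p 0<ε)
    (gap⇒≤ (seq x i ℚ.+ ½ ℚ.* ε ℚ.- (seq x i ℚ.+ ε))
      (≤⇒0≤gap (ℚ.≤-trans (f i (ℕ.m≤m⊔n M N)) (g i (ℕ.m≤n⊔m M N))))
      (solve 2 (λ x ε →
        (x :+ con ½ :* ε :- (x :+ ε)) :+ con ½ :* ε := con 0ℚ) refl (seq x i) ε)))
  where
  open +-*-Solver
  i = M ℕ.⊔ N

-- Real arithmetic acts termwise, so the identity can be checked by the rational solver at each
-- index; the slack ε comes from the bound on `w`.
gapℝ⇒≤ : ∀ x y w → 0ℝ ≤ w → (∀ i → seq w i ℚ.+ seq x i ≡ seq y i) → x ≤ y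
gapℝ⇒≤ x y w 0≤w eq ε 0<ε with N , f ← 0≤w ε 0<ε = N , λ i i≥ →
  gap⇒≤ (seq w i ℚ.+ ε) (f i i≥)
    (trans
      (solve 3 (λ w x ε → (w :+ ε) :+ x := (w :+ x) :+ ε) refl (seq w i) (seq x i) ε)
      (cong (ℚ._+ ε) (eq i)))
  where open +-*-Solver

≤⇒0≤gapℝ : ∀ x y → x ≤ y → 0ℝ ≤ y - x
≤⇒0≤gapℝ x y x≤y ε 0<ε with N , f ← x≤y ε 0<ε = N , λ i i≥ →
  subst (0ℚ ℚ.≤_)
    (solve 3 (λ x y ε → (y :+ ε) :- x := (y :- x) :+ ε) refl (seq x i) (seq y i) ε)
    (≤⇒0≤gap (f i i≥))
  where open +-*-Solver

0≤x+y : ∀ x y → 0ℝ ≤ x → 0ℝ ≤ y → 0ℝ ≤ x + y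
0≤x+y x y 0≤x 0≤y =
  -- The gap between `y` and `x + y` is `x` itself.
  ≤-trans 0ℝ y (x + y) 0≤y (gapℝ⇒≤ y (x + y) x 0≤x (λ _ → refl))

-- Past the modulus for tolerance 1, every term lies within 1 of the term at `N`. Only an upper
-- bound is kept, as `almost-nonNeg-*` asks for nothing more.
cauchy⇒bounded : ∀ x → ∃[ B ] (0ℚ ℚ.< B × ∃[ N ] (∀ i → N ℕ.≤ i → seq x i ℚ.≤ B))
cauchy⇒bounded x with N , f ← cauchy x 1ℚ (ℚ.positive⁻¹ 1ℚ) =
  ∣ seq x N ∣ ℚ.+ 1ℚ ,
  ℚ.+-mono-≤-< (ℚ.0≤∣p∣ (seq x N)) (ℚ.positive⁻¹ 1ℚ) ,
  N , λ i i≥ → ℚ.≤-trans (∣p-q∣<r⇒p≤q+r (f i N i≥ ℕ.≤-refl))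
                 (ℚ.+-monoˡ-≤ 1ℚ (p≤∣p∣ (seq x N)))

0≤x*y : ∀ x y → 0ℝ ≤ x → 0ℝ ≤ y → 0ℝ ≤ x * y
0≤x*y x y 0≤x 0≤y ε 0<ε =
  let (A , 0<A , M₁ , x≤A) = cauchy⇒bounded x
      (B , 0<B , N₁ , y≤B) = cauchy⇒bounded y
      -- `A + B` serves as a common upper bound for both factors, and δ is chosen so that the error
      -- (A + B) δ is exactly ε.
      0<A+B = ℚ.+-mono-< 0<A 0<B
      (δ , 0<δ , [A+B]*δ≡ε) = ∃-divisor 0<ε 0<A+B
      (M₂ , f) = 0≤x δ 0<δ
      (N₂ , g) = 0≤y δ 0<δ
      M = M₁ ℕ.⊔ M₂
      N = N₁ ℕ.⊔ N₂
  in M ℕ.⊔ N , λ i i≥ →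
    let i≥M = ℕ.m⊔n≤o⇒m≤o M N i≥
        i≥N = ℕ.m⊔n≤o⇒n≤o M N i≥
    in subst (λ t → 0ℚ ℚ.≤ seq x i ℚ.* seq y i ℚ.+ t) [A+B]*δ≡ε
      (almost-nonNeg-* (seq x i) (seq y i) δ (A ℚ.+ B)
        (f i (ℕ.m⊔n≤o⇒n≤o M₁ M₂ i≥M)) (g i (ℕ.m⊔n≤o⇒n≤o N₁ N₂ i≥N))
        (ℚ.≤-trans (x≤A i (ℕ.m⊔n≤o⇒m≤o M₁ M₂ i≥M))
          (gap⇒≤ B (ℚ.<⇒≤ 0<B) (ℚ.+-comm B A)))
        (ℚ.≤-trans (y≤B i (ℕ.m⊔n≤o⇒m≤o N₁ N₂ i≥N))
          (gap⇒≤ A (ℚ.<⇒≤ 0<A) refl))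
        (ℚ.<⇒≤ 0<δ) (ℚ.<⇒≤ 0<A+B))

-- Squares are nonnegative term by term, whatever the sign of `x`; this yields the lower bound on h
-- 1, whose sign is not known beforehand.
0≤x*x : ∀ x → 0ℝ ≤ x * x
0≤x*x x ε 0<ε = 0 , λ i _ → ℚ.+-mono-≤ (0≤p*p (seq x i)) (ℚ.<⇒≤ 0<ε)

-- The unit interval

record InUnit (x : ℝ) : Set where
  constructor unit
  field
    0≤ : 0ℝ ≤ x
    ≤1 : x ≤ 1ℝ

x*x≤x⇒InUnit : ∀ x → x * x ≤ x → InUnit x
x*x≤x⇒InUnit x x²≤x = unit (≤-trans 0ℝ (x * x) x (0≤x*x x) x²≤x)
  -- 1 − x = (1 − x)² + (x − x²)
  (gapℝ⇒≤ x 1ℝ ((1ℝ - x) * (1ℝ - x) + (x - x * x))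
    (0≤x+y ((1ℝ - x) * (1ℝ - x)) (x - x * x)
      (0≤x*x (1ℝ - x)) (≤⇒0≤gapℝ (x * x) x x²≤x))
    (λ i → solve 1 (λ x →
      ((con 1ℚ :- x) :* (con 1ℚ :- x) :+ (x :- x :* x)) :+ x := con 1ℚ) refl (seq x i)))
  where open +-*-Solver

x*y≤x : ∀ x y → 0ℝ ≤ x → y ≤ 1ℝ → x * y ≤ x
x*y≤x x y 0≤x y≤1 = gapℝ⇒≤ (x * y) x (x * (1ℝ - y))
  (0≤x*y x (1ℝ - y) 0≤x (≤⇒0≤gapℝ y 1ℝ y≤1))
  (λ i → solve 2 (λ x y → x :* (con 1ℚ :- y) :+ x :* y := x) refl (seq x i) (seq y i))
  where open +-*-Solver

0≤1-x*y : ∀ {x y} → InUnit x → InUnit y → 0ℝ ≤ 1ℝ - x * y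
0≤1-x*y {x} {y} (unit 0≤x x≤1) (unit _ y≤1) =
  ≤⇒0≤gapℝ (x * y) 1ℝ (≤-trans (x * y) x 1ℝ (x*y≤x x y 0≤x y≤1) x≤1)

triangle-1-x*y : ∀ {a b c} → InUnit a → InUnit b → InUnit c →
                 1ℝ - a * c ≤ (1ℝ - a * b) + (1ℝ - b * c)
triangle-1-x*y {a} {b} {c} (unit 0≤a a≤1) (unit _ b≤1) (unit 0≤c c≤1) =
  gapℝ⇒≤ (1ℝ - a * c) ((1ℝ - a * b) + (1ℝ - b * c)) (u + v)
    (0≤x+y u v
      (0≤x*y (1ℝ - a) (1ℝ - c) (≤⇒0≤gapℝ a 1ℝ a≤1) (≤⇒0≤gapℝ c 1ℝ c≤1))
      (0≤x*y (a + c) (1ℝ - b) (0≤x+y a c 0≤a 0≤c) (≤⇒0≤gapℝ b 1ℝ b≤1)))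
    (λ i → solve 3 (λ a b c →
      ((con 1ℚ :- a) :* (con 1ℚ :- c) :+ (a :+ c) :* (con 1ℚ :- b)) :+ (con 1ℚ :- a :* c)
        := (con 1ℚ :- a :* b) :+ (con 1ℚ :- b :* c)) refl (seq a i) (seq b i) (seq c i))
  where
  open +-*-Solver
  u = (1ℝ - a) * (1ℝ - c)
  v = (a + c) * (1ℝ - b)

1-x*y≉0 : ∀ x y → 0ℝ ≤ x → x < 1ℝ → y ≤ 1ℝ → ¬ (1ℝ - x * y ≈ 0ℝ)
1-x*y≉0 x y 0≤x x<1 y≤1 1-xy≈0 =
  <⇒≱ x 1ℝ x<1 (≤-trans 1ℝ (x * y) x 1≤x*y (x*y≤x x y 0≤x y≤1))
  where
  open +-*-Solver
  1≤x*y : 1ℝ ≤ x * y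
  1≤x*y = gapℝ⇒≤ 1ℝ (x * y) (0ℝ - (1ℝ - x * y))
    (≤⇒0≤gapℝ (1ℝ - x * y) 0ℝ (≈⇒≤ (1ℝ - x * y) 0ℝ 1-xy≈0))
    (λ i → solve 2 (λ x y →
      (con 0ℚ :- (con 1ℚ :- x :* y)) :+ con 1ℚ := x :* y) refl (seq x i) (seq y i))

-- Functions in 𝓘

𝓘⇒InUnit : ∀ {h} → 𝓘 h → ∀ m → InUnit (h m)
-- The `NonZero` proof is irrelevant, so a usable one is recomputed by decidability to exclude 0.
𝓘⇒InUnit h∈𝓘 (zero ,ᵣ [ 0≢0 ]) =
  contradiction refl (ℕ.≢-nonZero⁻¹ 0 {{recompute (ℕ.nonZero? 0) 0≢0}})
𝓘⇒InUnit {h} h∈𝓘 m@(suc zero ,ᵣ _) =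
  -- `m *⁺ m` computes to `m`, since 1 times 1 is 1 and the membership proofs are irrelevant.
  x*x≤x⇒InUnit (h m) (≈⇒≤ (h m * h m) (h m)
    (≈-sym (h m) (h m * h m) (mult m m (1-coprimeTo 1))))
  where open IsMultiplicative (𝓘.multiplicative h∈𝓘)
𝓘⇒InUnit h∈𝓘 m@(suc (suc _) ,ᵣ _)
  with 0≤hm , hm≤1 ← 𝓘.bounds h∈𝓘 m (s≤s (s≤s z≤n)) = unit 0≤hm hm≤1

gcd⁺-divisor : ∀ {n} (x : D n) → gcd⁺ (D→ℤ {n} x) n ≡ value x
gcd⁺-divisor {n} (x ,ᵣ [ x∣n ]) = value-injective (∣-antisym
  (gcd[m,n]∣m (value x) (value n))
  (gcd-greatest ∣-refl (recompute (value x ∣? value n) x∣n)))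

-- The pseudometric on the integers and its pullback

module _ {n : ℕ⁺} {h : ℕ⁺ → ℝ} (h∈𝓘 : 𝓘 h) where

  private
    inUnit : ∀ x → InUnit (h (gcd⁺ x n))
    inUnit x = 𝓘⇒InUnit h∈𝓘 (gcd⁺ x n)

  -- Settles the triangle inequality when its two endpoints coincide and the left side is zero.
  0≤dist : ∀ x y → 0ℝ ≤ dist n h x y
  0≤dist x y with x ℤ.≟ y
  ... | yes _ = ≗⇒≤ 0ℝ 0ℝ (λ _ → refl)
  ... | no  _ = 0≤1-x*y (inUnit x) (inUnit y)

  dist-self : ∀ x → dist n h x x ≈ 0ℝ
  dist-self x with x ℤ.≟ x
  ... | yes _  = ≗⇒≈ 0ℝ 0ℝ (λ _ → refl)
  ... | no x≢x = contradiction refl x≢x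

  dist-sym : ∀ x y → dist n h x y ≈ dist n h y x
  dist-sym x y with x ℤ.≟ y | y ℤ.≟ x
  ... | yes _   | yes _   = ≗⇒≈ 0ℝ 0ℝ (λ _ → refl)
  ... | yes x≡y | no y≢x  = contradiction (sym x≡y) y≢x
  ... | no x≢y  | yes y≡x = contradiction (sym y≡x) x≢y
  ... | no _    | no _    = ≗⇒≈ (1ℝ - a * b) (1ℝ - b * a) (λ i → cong (λ t → 1ℚ ℚ.- t)
    (ℚ.*-comm (seq a i) (seq b i)))
    where
    a = h (gcd⁺ x n)
    b = h (gcd⁺ y n)

  dist-triangle : ∀ x y z → dist n h x z ≤ dist n h x y + dist n h y z
  dist-triangle x y z with x ℤ.≟ z
  ... | yes _ = 0≤x+y (dist n h x y) (dist n h y z) (0≤dist x y) (0≤dist y z)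
  ... | no x≢z with x ℤ.≟ y | y ℤ.≟ z
  ...   | yes refl | yes x≡z  = contradiction x≡z x≢z
  ...   | yes refl | no _     = ≗⇒≤ d (0ℝ + d) (λ i → sym (ℚ.+-identityˡ (seq d i)))
    where d = 1ℝ - h (gcd⁺ x n) * h (gcd⁺ z n)
  ...   | no _     | yes refl = ≗⇒≤ d (d + 0ℝ) (λ i → sym (ℚ.+-identityʳ (seq d i)))
    where d = 1ℝ - h (gcd⁺ x n) * h (gcd⁺ z n)
  ...   | no _     | no _     = triangle-1-x*y (inUnit x) (inUnit y) (inUnit z)

  dist-isPseudometric : IsPseudometric (dist n h)
  dist-isPseudometric = record
    { self = dist-self ; symm = dist-sym ; triangle = dist-triangle }

on-isPseudometric : ∀ {S T : Set} {d : DistanceFunction T ℝ} (f : S → T) →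
                    IsPseudometric d → IsPseudometric (d on f)
on-isPseudometric f d-isPseudometric = record
  { self     = λ x → self (f x)
  ; symm     = λ x y → symm (f x) (f y)
  ; triangle = λ x y z → triangle (f x) (f y) (f z)
  }
  where open IsPseudometric d-isPseudometric

-- Separation of distinct divisors

≢⇒1<⊎1< : ∀ m n .{{_ : NonZero m}} .{{_ : NonZero n}} → m ≢ n → 1 ℕ.< m ⊎ 1 ℕ.< n
≢⇒1<⊎1< (suc (suc _)) _             _   = inj₁ (s≤s (s≤s z≤n))
≢⇒1<⊎1< _             (suc (suc _)) _   = inj₂ (s≤s (s≤s z≤n))
≢⇒1<⊎1< 1             1             1≢1 = contradiction refl 1≢1

module _ {n : ℕ⁺} {h : ℕ⁺ → ℝ} (h∈𝓘₁ : 𝓘₁ h) where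
  open 𝓘₁ h∈𝓘₁

  1<⇒dist≉0 : ∀ (x y : D n) → x ≢ y → 1 ℕ.< value (value x) → ¬ (distD n h x y ≈ 0ℝ)
  1<⇒dist≉0 x y x≢y 1<x with D→ℤ {n} x ℤ.≟ D→ℤ {n} y
  ... | yes x≡y = contradiction (value-injective (value-injective (ℤ.+-injective x≡y))) x≢y
  -- Since x divides n, gcd (x , n) is x; after the rewrite the first factor is h x, to which the
  -- strict bound applies.
  ... | no _ with 0≤hx , hx<1 ← strict-bounds (value x) 1<x
             rewrite gcd⁺-divisor {n} x =
    1-x*y≉0 (h (value x)) (h m) 0≤hx hx<1 (InUnit.≤1 (𝓘⇒InUnit ∈𝓘 m))
    where m = gcd⁺ (D→ℤ {n} y) n

  distD-indiscernable : ∀ {x y : D n} → distD n h x y ≈ 0ℝ → x ≡ y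
  distD-indiscernable {x@((i ,ᵣ [ i≢0 ]) ,ᵣ _)} {y@((j ,ᵣ [ j≢0 ]) ,ᵣ _)} d≈0 =
    -- Equality on `D n` is decidable, so it suffices to refute `x ≢ y`.
    decidable-stable (_≟_ (_≟_ ℕ._≟_) x y) λ x≢y →
      [ (λ 1<i → 1<⇒dist≉0 x y x≢y 1<i d≈0)
      -- If the second divisor is the one exceeding 1, symmetry of the distance swaps the roles.
      , (λ 1<j → 1<⇒dist≉0 y x (λ y≡x → x≢y (sym y≡x)) 1<j
          (≈-trans (distD n h y x) (distD n h x y) 0ℝ
            (dist-sym {n} ∈𝓘 (D→ℤ {n} y) (D→ℤ {n} x)) d≈0))
      ]′ (≢⇒1<⊎1< i j {{i≢0}} {{j≢0}} (λ { refl → x≢y refl }))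

theorem3p7 : (n : ℕ⁺) → 1 ℕ.< value n → (h : ℕ⁺ → ℝ) → 𝓘 h →
    IsPseudometric (dist n h) × IsPseudometric (distD n h) ×
    (𝓘₁ h → IsMetric (distD n h))
theorem3p7 n _ h h∈𝓘 = pm , pmD , λ h∈𝓘₁ → record
  { isPseudometric = pmD ; indiscernable = distD-indiscernable h∈𝓘₁ }
  where
  pm = dist-isPseudometric h∈𝓘
  pmD = on-isPseudometric (D→ℤ {n}) pm
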